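{- Let $\mathcal{F}_1$ and $\mathcal{F}_2$ be two finite sets of graphs that have the Erdős–Hajnal property. Let $\mathcal{H}$ be a finite set of graphs. Suppose that for every $\overline{\mathcal{H}}$-free graph $G$ and every $(\ell,w)$-comb $((a_i,B_i),i\in[\ell])$ in $G$ with $\ell,w\geq 4$, if there exists a vertex $v\in V(G)\setminus(\{a_i:i\in[\ell]\}\cup\bigcup_{i\in[\ell]}B_i)$ such that $v$ is complete to $\bigcup_{i\in[\ell]}B_i$ and anti-complete to $\{a_i:i\in[\ell]\}$, then for each $i\in[\ell]$, $B_i$ can be partitioned into $X_i,Y_i$ such that (1) (the subgraph induced on) $Y_i$ is $\mathcal{F}_1$-free; (2) $X_i$ can be partitioned into $(A^i_1,\ldots,A^i_{t_i})$ such that (2.1) $(A^i_1,\ldots,A^i_{t_i})$ is a pure blockade; (2.2) the pattern of $(A^i_1,\ldots,A^i_{t_i})$, i.e. the graph whose vertices are the blocks $A^i_1,\ldots,A^i_{t_i}$, with two vertices adjacent if and only if the corresponding blocks are complete to each other, is $\mathcal{F}_2$-free; (2.3) for each $j\in[t_i]$ and every vertex $u\in\bigcup_{k\in[\ell]\setminus\{i\}}B_k$, $u$ is pure to $A^i_j$. Then $\mathcal{H}$ has property $(*)$.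
   Context: All graphs are finite and simple; $\overline{G}$ is the complement of $G$, and $[\ell]=\{1,\ldots,\ell\}$. A clique (stable set) is a set of pairwise adjacent (nonadjacent) vertices. For a set of graphs $\mathcal{F}$, $\overline{\mathcal{F}}=\{\overline{F}:F\in\mathcal{F}\}$, and $G$ is $\mathcal{F}$-free if no induced subgraph of $G$ is isomorphic to a member of $\mathcal{F}$. A nonempty set $\mathcal{F}$ of graphs has the Erdős–Hajnal property if there is $c>0$ such that every $n$-vertex $\mathcal{F}$-free graph has a clique or stable set of size at least $n^c$. For disjoint $X,Y\subseteq V(G)$, $X$ is complete (anti-complete) to $Y$ if every vertex of $X$ is adjacent (nonadjacent) to every vertex of $Y$; $X$ is pure to $Y$ if it is complete or anti-complete to $Y$; for a vertex $u$ these are applied to $X=\{u\}$. An $(\ell,w)$-blockade in $G$ (where $\ell,w$ are nonnegative reals, not necessarily integers) is a sequence $(B_1,\ldots,B_k)$ of disjoint subsets (blocks) of $V(G)$ with $k\ge \ell$ and $|B_i|\ge w$ for all $i$; a blockade without parameters is just a sequence of disjoint vertex subsets. It is complete (anti-complete, pure) if its blocks are pairwise complete (anti-complete, pure). For a positive integer $\ell$ and real $w\ge0$, an $(\ell,w)$-comb in $G$ is a sequence of pairs $((a_i,B_i),i\in[\ell])$ such that $(B_1,\ldots,B_\ell)$ is an $(\ell,w)$-blockade; $a_1,\ldots,a_\ell$ are distinct vertices; $\{a_1,\ldots,a_\ell\},B_1,\ldots,B_\ell$ are disjoint subsets of $V(G)$; and for all distinct $i,j\in[\ell]$, $a_i$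 is complete to $B_i$ and anti-complete to $B_j$. Property $(*)$: a finite class $\mathcal{H}$ has property $(*)$ if there exist $c_1,c_2,c_3>0$ such that for every $\overline{\mathcal{H}}$-free graph $G$ the following holds. If there is an $(\ell,w)$-comb $((a_i,B_i),i\in[\ell])$ in $G$ with $\ell,w\ge4$, and there is a vertex $v\in V(G)\setminus(\{a_i:i\in[\ell]\}\cup\bigcup_{i\in[\ell]}B_i)$ that is complete to $\bigcup_{i\in[\ell]}B_i$ and anti-complete to $\{a_i:i\in[\ell]\}$, then one of the following holds: (i) $G$ has a clique or stable set of size at least $w^{c_1}$; (ii) $G$ has a complete or anti-complete $(k,w/k^{c_2})$-blockade for some $k\ge\ell^{c_3}$; (iii) $G$ has a pure $(\ell,w/\ell^2)$-blockade. -}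

module Defs where

open import Level using (0ℓ)
open import Data.Bool using (true; false)
open import Data.Empty using (⊥-elim)
open import Data.Fin using (Fin; zero; suc)
open import Data.Fin.Properties as Fin using (all?)
open import Data.Fin.Subset using (Subset; _∈_; _∉_; _∩_; _∪_; ∣_∣; ⁅_⁆; Empty)
open import Data.Fin.Subset.Properties using (_∈?_)
open import Data.Integer as ℤ using (+_)
import Data.Integer.Properties as ℤ
open import Data.List using (List; []; map)
open import Data.List.Relation.Unary.All using (All)
open import Data.Nat as ℕ using (ℕ; zero; suc)
import Data.Nat.Properties as ℕ
open import Data.Nat.Coprimality using (1-coprimeTo)
import Data.Nat.Coprimality as Coprime
open import Data.Product using (Σ-syntax; ∃-syntax; _×_; _,_; proj₁; proj₂)
open import Data.Rational as ℚ using (ℚ; mkℚ; 0ℚ; 1ℚ; ↥_; ↧ₙ_; _⊓_; _⊔_)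
import Data.Rational.Properties as ℚ
open import Data.Sum using (_⊎_; inj₁; inj₂)
open import Data.Vec using ([]; _∷_)
open import Function using (_∘_; _⇔_)
open import Function.Bundles using (_↔_; Inverse)
open import Function.Definitions using (Injective)
open import Relation.Binary using (Rel; Symmetric; Irreflexive; Decidable)
open import Relation.Binary.PropositionalEquality
  using (_≡_; _≢_; refl; sym; trans; cong; subst)
open import Relation.Nullary using (¬_; yes; no; contradiction)
open import Relation.Nullary.Decidable using (_×-dec_; _→-dec_; ¬?)

open import Algebra.Definitions.RawSemiring ℚ.+-*-rawSemiring
  using () renaming (_^_ to _^ℚ_)

------------------------------------------------------------------------
-- Nonnegative real numbers

-- A nonnegative real is given by its left Dedekind cut {q ∈ ℚ ∣ q < x}
-- (one-sided cuts without greatest element, as in Rudin), so that x ≤ y is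
-- inclusion of cuts.  Constructively these are the lower reals; classically they
-- are exactly the reals x ≥ 0.

record ℝ≥0 : Set₁ where
  field
    Below    : ℚ → Set
    negative : ∀ {q} → q ℚ.< 0ℚ → Below q
    down     : ∀ {p q} → p ℚ.≤ q → Below q → Below p
    open′    : ∀ {q} → Below q → ∃[ p ] q ℚ.< p × Below p
    bounded  : ∃[ q ] ¬ Below q

open ℝ≥0

infix 4 _≤_ _<_

_≤_ : ℝ≥0 → ℝ≥0 → Set
x ≤ y = ∀ {q} → Below x q → Below y q

_<_ : ℝ≥0 → ℝ≥0 → Set
x < y = ∃[ q ] ¬ Below x q × Below y q

fromℕ : ℕ → ℝ≥0
fromℕ n = record
  { Below    = ℚ._< n/1
  ; negative = λ q<0 → ℚ.<-≤-trans q<0 (ℚ.nonNegative⁻¹ n/1)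
  ; down     = ℚ.≤-<-trans
  ; open′    = λ q<n → let p , q<p , p<n = ℚ.<-dense q<n in p , q<p , p<n
  ; bounded  = n/1 , ℚ.<-irrefl refl
  }
  where
  n/1 : ℚ
  n/1 = mkℚ (+ n) 0 (Coprime.sym (1-coprimeTo n))

0ℝ : ℝ≥0
0ℝ = fromℕ 0

fromℕ-positive : ∀ {n} → 0 ℕ.< n → 0ℝ < fromℕ n
fromℕ-positive {suc n} _ = 0ℚ , ℚ.<-irrefl refl , ℚ.positive⁻¹ (mkℚ (+ suc n) 0 _)

private
  ∉⇒> : ∀ x {p q} → Below x p → ¬ Below x q → p ℚ.< q
  ∉⇒> x p∈ q∉ = ℚ.≰⇒> (λ q≤p → q∉ (down x q≤p p∈))

  ∉⇒≥0 : ∀ x {q} → ¬ Below x q → 0ℚ ℚ.≤ q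
  ∉⇒≥0 x q∉ = ℚ.≮⇒≥ (q∉ ∘ negative x)

  positive-member : ∀ y → 0ℝ < y → ∃[ r ] 0ℚ ℚ.< r × Below y r
  positive-member y (q , q≮0 , q∈) =
    let r , q<r , r∈ = open′ y q∈ in r , ℚ.≤-<-trans (ℚ.≮⇒≥ q≮0) q<r , r∈

-- q < x / y  iff  q * u < x for some rational u ≥ y.

infixl 7 _/_[_]

_/_[_] : (x y : ℝ≥0) → 0ℝ < y → ℝ≥0
x / y [ y>0 ] = record
  { Below    = λ q → ∃[ u ] 0ℚ ℚ.< u × ¬ Below y u × Below x (q ℚ.* u)
  ; negative = λ {q} q<0 →
      let u , u∉ = bounded y
          u>0    = ℚ.<-trans r>0 (∉⇒> y r∈ u∉)
      in u , u>0 , u∉ , negative x (subst (q ℚ.* u ℚ.<_) (ℚ.*-zeroˡ u)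
           (ℚ.*-monoˡ-<-pos u {{ℚ.positive u>0}} q<0))
  ; down     = λ { p≤q (u , u>0 , u∉ , qu∈) → u , u>0 , u∉ ,
      down x (ℚ.*-monoʳ-≤-nonNeg u {{ℚ.nonNegative (ℚ.<⇒≤ u>0)}} p≤q) qu∈ }
  ; open′    = λ { {q} (u , u>0 , u∉ , qu∈) →
      let s , qu<s , s∈ = open′ x qu∈
          instance
            u⁺ : ℚ.Positive u
            u⁺ = ℚ.positive u>0
            u≢0 : ℚ.NonZero u
            u≢0 = ℚ.pos⇒nonZero u
          s/u*u≡s = trans (ℚ.*-assoc s (ℚ.1/ u) u)
                      (trans (cong (s ℚ.*_) (ℚ.*-inverseˡ u)) (ℚ.*-identityʳ s))
      in s ℚ.* ℚ.1/ u
       , ℚ.*-cancelʳ-<-nonNeg u {{ℚ.pos⇒nonNeg u}} (subst (q ℚ.* u ℚ.<_) (sym s/u*u≡s) qu<s)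
       , u , u>0 , u∉ , subst (Below x) (sym s/u*u≡s) s∈ }
  ; bounded  =
      let M , M∉ = bounded x
          instance
            r⁺ : ℚ.Positive r
            r⁺ = ℚ.positive r>0
            r≢0 : ℚ.NonZero r
            r≢0 = ℚ.pos⇒nonZero r
          Z = M ℚ.* ℚ.1/ r
          Z*r≡M = trans (ℚ.*-assoc M (ℚ.1/ r) r)
                    (trans (cong (M ℚ.*_) (ℚ.*-inverseˡ r)) (ℚ.*-identityʳ M))
          instance
            M⁰ : ℚ.NonNegative M
            M⁰ = ℚ.nonNegative (∉⇒≥0 x M∉)
            1/r⁰ : ℚ.NonNegative (ℚ.1/ r)
            1/r⁰ = ℚ.pos⇒nonNeg (ℚ.1/ r) {{ℚ.1/pos⇒pos r}}
            Z⁰ : ℚ.NonNegative Z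
            Z⁰ = ℚ.nonNeg*nonNeg⇒nonNeg M (ℚ.1/ r)
      in Z , λ { (u , _ , u∉ , Zu∈) →
           M∉ (down x (subst (ℚ._≤ Z ℚ.* u) Z*r≡M
                 (ℚ.*-monoˡ-≤-nonNeg Z (ℚ.<⇒≤ (∉⇒> y r∈ u∉)))) Zu∈) }
  }
  where
  r   = proj₁ (positive-member y y>0)
  r>0 = proj₁ (proj₂ (positive-member y y>0))
  r∈  = proj₂ (proj₂ (positive-member y y>0))

-- y ≤[ x ^ a/b ]  is  y ≤ x^(a/b)  for rationals x, y, a/b ≥ 0, i.e. y^b ≤ x^a.

_≤[_^_] : ℚ → ℚ → ℚ → Set
y ≤[ x ^ r ] = y ^ℚ ↧ₙ r ℚ.≤ x ^ℚ ℤ.∣ ↥ r ∣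

-- For b > 0 and c ≥ 0, b^c is the supremum of min(x^r, x^s) over rationals
-- 0 < x < b and 0 ≤ r ≤ c ≤ s.  (The minimum is x^r for x ≥ 1 and x^s for
-- x ≤ 1, so bases on both sides of 1 are covered.)  For b = 0 the value is 0.

record PowerWitness (b c : ℝ≥0) (q : ℚ) : Set where
  constructor powerWitness
  field
    y x r s : ℚ
    q<y  : q ℚ.< y
    0≤y  : 0ℚ ℚ.≤ y
    0<x  : 0ℚ ℚ.< x
    x<b  : Below b x
    0≤r  : 0ℚ ℚ.≤ r
    r≤c  : ∀ {p} → p ℚ.< r → Below c p
    c≤s  : ¬ Below c s
    y≤xʳ : y ≤[ x ^ r ]
    y≤xˢ : y ≤[ x ^ s ]

private
  ^-nonNeg : ∀ x n → 0ℚ ℚ.≤ x → 0ℚ ℚ.≤ x ^ℚ n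
  ^-nonNeg x zero    _   = ℚ.nonNegative⁻¹ 1ℚ
  ^-nonNeg x (suc n) 0≤x = ℚ.nonNegative⁻¹ (x ℚ.* x ^ℚ n)
    {{ℚ.nonNeg*nonNeg⇒nonNeg x {{ℚ.nonNegative 0≤x}} (x ^ℚ n) {{ℚ.nonNegative (^-nonNeg x n 0≤x)}}}}

  *-mono : ∀ {a b c d} → 0ℚ ℚ.≤ b → 0ℚ ℚ.≤ c → a ℚ.≤ b → c ℚ.≤ d → a ℚ.* c ℚ.≤ b ℚ.* d
  *-mono {a} {b} {c} {d} 0≤b 0≤c a≤b c≤d = ℚ.≤-trans
    (ℚ.*-monoʳ-≤-nonNeg c {{ℚ.nonNegative 0≤c}} a≤b)
    (ℚ.*-monoˡ-≤-nonNeg b {{ℚ.nonNegative 0≤b}} c≤d)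

  ^-mono : ∀ {x y} n → 0ℚ ℚ.≤ x → x ℚ.≤ y → x ^ℚ n ℚ.≤ y ^ℚ n
  ^-mono zero    _   _   = ℚ.≤-refl
  ^-mono {x} (suc n) 0≤x x≤y =
    *-mono (ℚ.≤-trans 0≤x x≤y) (^-nonNeg x n 0≤x) x≤y (^-mono n 0≤x x≤y)

  1≤^ : ∀ {x} n → 1ℚ ℚ.≤ x → 1ℚ ℚ.≤ x ^ℚ n
  1≤^ zero    _   = ℚ.≤-refl
  1≤^ {x} (suc n) 1≤x = *-mono {1ℚ} {x} {1ℚ} (ℚ.≤-trans 0≤1 1≤x) 0≤1 1≤x (1≤^ n 1≤x)
    where 0≤1 = ℚ.nonNegative⁻¹ 1ℚ

  ^-step : ∀ {x} n → 1ℚ ℚ.≤ x → x ^ℚ n ℚ.≤ x ^ℚ suc n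
  ^-step {x} n 1≤x = subst (ℚ._≤ x ^ℚ suc n) (ℚ.*-identityˡ (x ^ℚ n))
    (ℚ.*-monoʳ-≤-nonNeg (x ^ℚ n) {{ℚ.nonNegative (^-nonNeg x n (ℚ.≤-trans (ℚ.nonNegative⁻¹ 1ℚ) 1≤x))}} 1≤x)

  ^-monoʳ : ∀ {x m n} → 1ℚ ℚ.≤ x → m ℕ.≤ n → x ^ℚ m ℚ.≤ x ^ℚ n
  ^-monoʳ {x} {m} {n} 1≤x m≤n = go (ℕ.≤⇒≤′ m≤n)
    where
    go : ∀ {n} → m ℕ.≤′ n → x ^ℚ m ℚ.≤ x ^ℚ n
    go (ℕ.≤′-reflexive refl) = ℚ.≤-refl
    go (ℕ.≤′-step {n} m≤n)   = ℚ.≤-trans (go m≤n) (^-step n 1≤x)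

  ^-≤1 : ∀ {x} n → 0ℚ ℚ.≤ x → x ℚ.≤ 1ℚ → x ^ℚ n ℚ.≤ 1ℚ
  ^-≤1 zero    _   _   = ℚ.≤-refl
  ^-≤1 {x} (suc n) 0≤x x≤1 =
    *-mono {x} {1ℚ} {x ^ℚ n} {1ℚ} (ℚ.nonNegative⁻¹ 1ℚ) (^-nonNeg x n 0≤x) x≤1 (^-≤1 n 0≤x x≤1)

  ^-pos : ∀ {x} n → 0ℚ ℚ.< x → 0ℚ ℚ.< x ^ℚ n
  ^-pos zero    _   = ℚ.positive⁻¹ 1ℚ
  ^-pos {x} (suc n) 0<x = ℚ.positive⁻¹ (x ℚ.* x ^ℚ n)
    {{ℚ.pos*pos⇒pos x {{ℚ.positive 0<x}} (x ^ℚ n) {{ℚ.positive (^-pos n 0<x)}}}}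

  ^-mono-< : ∀ {z y} d → 0ℚ ℚ.≤ z → z ℚ.< y → z ^ℚ suc d ℚ.< y ^ℚ suc d
  ^-mono-< {z} {y} d 0≤z z<y = ℚ.≤-<-trans
    (ℚ.*-monoˡ-≤-nonNeg z {{ℚ.nonNegative 0≤z}} (^-mono d 0≤z (ℚ.<⇒≤ z<y)))
    (ℚ.*-monoˡ-<-pos (y ^ℚ d) {{ℚ.positive (^-pos d (ℚ.≤-<-trans 0≤z z<y))}} z<y)

  ^-* : ∀ x m n → (x ^ℚ m) ^ℚ n ≡ x ^ℚ (m ℕ.* n)
  ^-* = Exp.^-assocʳ
    where
    open import Algebra.Bundles using (CommutativeRing)
    import Algebra.Properties.Semiring.Exp
      (CommutativeRing.semiring ℚ.+-*-commutativeRing) as Exp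

  ≤⇒num≤ : ∀ {r N} → 0ℚ ℚ.≤ r → r ℚ.≤ N → ℤ.∣ ↥ r ∣ ℕ.≤ ℤ.∣ ↥ N ∣ ℕ.* ↧ₙ r
  ≤⇒num≤ {mkℚ (+ a) b-1 _} {mkℚ (+ m) d-1 _} _ (ℚ.*≤* h) =
    ℕ.≤-trans (ℕ.m≤m*n a (suc d-1))
      (ℤ.drop‿+≤+ (subst (ℤ._≤ + (m ℕ.* suc b-1)) (sym (ℤ.pos-* a (suc d-1)))
        (subst ((+ a) ℤ.* (+ suc d-1) ℤ.≤_) (sym (ℤ.pos-* m (suc b-1))) h)))
  ≤⇒num≤ {mkℚ (ℤ.-[1+ _ ]) _ _} (ℚ.*≤* ())
  ≤⇒num≤ {mkℚ (+ a) b-1 _} {mkℚ (ℤ.-[1+ m ]) d-1 _} _ (ℚ.*≤* h) =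
    contradiction (subst (ℤ._≤ _) (sym (ℤ.pos-* a (suc d-1))) h) λ ()

  power-bounded : ∀ b c → ∃[ Z ] 0ℚ ℚ.≤ Z × ¬ PowerWitness b c Z
  power-bounded b c = Z , 0≤Z , absurd
    where
    M  = proj₁ (bounded b)
    M∉ = proj₂ (bounded b)
    N  = proj₁ (bounded c)
    N∉ = proj₂ (bounded c)
    M′ = M ⊔ 1ℚ
    1≤M′ = ℚ.p≤q⊔p M 1ℚ
    Z = M′ ^ℚ ℤ.∣ ↥ N ∣
    0≤Z = ℚ.≤-trans (ℚ.nonNegative⁻¹ 1ℚ) (1≤^ ℤ.∣ ↥ N ∣ 1≤M′)
    absurd : ¬ PowerWitness b c Z
    absurd (powerWitness y x r s Z<y _ 0<x x<b 0≤r r≤c _ y≤xʳ _) =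
      ℚ.<-irrefl refl (ℚ.<-≤-trans (^-mono-< (ℚ.denominator-1 r) 0≤Z Z<y)
        (ℚ.≤-trans y≤xʳ
        (ℚ.≤-trans (^-mono num (ℚ.<⇒≤ 0<x) (ℚ.≤-trans (ℚ.<⇒≤ (∉⇒> b x<b M∉)) (ℚ.p≤p⊔q M 1ℚ)))
        (ℚ.≤-trans (^-monoʳ 1≤M′ (≤⇒num≤ {r} {N} 0≤r (ℚ.≮⇒≥ (N∉ ∘ r≤c))))
        (ℚ.≤-reflexive (sym (^-* M′ ℤ.∣ ↥ N ∣ (↧ₙ r))))))))
      where num = ℤ.∣ ↥ r ∣

infixr 8 _^_

_^_ : ℝ≥0 → ℝ≥0 → ℝ≥0
b ^ c = record
  { Below    = λ q → q ℚ.< 0ℚ ⊎ PowerWitness b c q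
  ; negative = inj₁
  ; down     = λ { p≤q (inj₁ q<0) → inj₁ (ℚ.≤-<-trans p≤q q<0)
                 ; p≤q (inj₂ w)   → inj₂ (record
                     { PowerWitness w ; q<y = ℚ.≤-<-trans p≤q (PowerWitness.q<y w) }) }
  ; open′    = λ { (inj₁ q<0) → let p , q<p , p<0 = ℚ.<-dense q<0 in p , q<p , inj₁ p<0
                 ; (inj₂ w)   → let p , q<p , p<y = ℚ.<-dense (PowerWitness.q<y w) in
                     p , q<p , inj₂ (record { PowerWitness w ; q<y = p<y }) }
  ; bounded  = let Z , 0≤Z , Z∉ = power-bounded b c in
      Z , λ { (inj₁ Z<0) → ℚ.<-irrefl refl (ℚ.≤-<-trans 0≤Z Z<0) ; (inj₂ w) → Z∉ w }
  }

^-positive : ∀ {b} c → 0ℝ < b → 0ℝ < b ^ c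
^-positive {b} c b>0 = 0ℚ , ℚ.<-irrefl refl , inj₂ (record
  { y = y ; x = x ; r = 0ℚ ; s = s
  ; q<y = ^-pos n m>0 ; 0≤y = 0≤y ; 0<x = x>0 ; x<b = x∈ ; 0≤r = ℚ.≤-refl
  ; r≤c = negative c ; c≤s = proj₂ (bounded c)
  ; y≤xʳ = ℚ.≤-trans (ℚ.≤-reflexive (ℚ.*-identityʳ y)) y≤1
  ; y≤xˢ = ℚ.≤-trans
      (ℚ.≤-trans (ℚ.*-monoˡ-≤-nonNeg y {{ℚ.nonNegative 0≤y}} (^-≤1 (ℚ.denominator-1 s) 0≤y y≤1))
        (ℚ.≤-reflexive (ℚ.*-identityʳ y)))
      (^-mono n (ℚ.<⇒≤ m>0) (ℚ.p⊓q≤p x 1ℚ))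
  })
  where
  x   = proj₁ (positive-member b b>0)
  x>0 = proj₁ (proj₂ (positive-member b b>0))
  x∈  = proj₂ (proj₂ (positive-member b b>0))
  s   = proj₁ (bounded c)
  n   = ℤ.∣ ↥ s ∣
  m   = x ⊓ 1ℚ
  m>0 : 0ℚ ℚ.< m
  m>0 with ℚ.⊓-sel x 1ℚ
  ... | inj₁ e = subst (0ℚ ℚ.<_) (sym e) x>0
  ... | inj₂ e = subst (0ℚ ℚ.<_) (sym e) (ℚ.positive⁻¹ 1ℚ)
  y   = m ^ℚ n
  0≤y = ℚ.<⇒≤ (^-pos n m>0)
  y≤1 = ^-≤1 n (ℚ.<⇒≤ m>0) (ℚ.p⊓q≤q x 1ℚ)

------------------------------------------------------------------------
-- Graphs

record Graph : Set₁ where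
  field
    order  : ℕ
    Adj    : Rel (Fin order) 0ℓ
    adj?   : Decidable Adj
    symm   : Symmetric Adj
    irrefl : Irreflexive _≡_ Adj

  Vertex : Set
  Vertex = Fin order

  VertexSet : Set
  VertexSet = Subset order

open Graph public

complement : Graph → Graph
complement G = record
  { order  = order G
  ; Adj    = λ u v → u ≢ v × ¬ Adj G u v
  ; adj?   = λ u v → ¬? (u Fin.≟ v) ×-dec ¬? (adj? G u v)
  ; symm   = λ { (u≢v , ¬uv) → u≢v ∘ sym , ¬uv ∘ symm G }
  ; irrefl = λ { refl (u≢u , _) → u≢u refl }
  }

-- The increasing enumeration of the elements of S.

element : ∀ {n} (S : Subset n) → Fin ∣ S ∣ → Fin n
element (true  ∷ S) zero    = zero
element (true  ∷ S) (suc i) = suc (element S i)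
element (false ∷ S) i       = suc (element S i)

element-injective : ∀ {n} (S : Subset n) → Injective _≡_ _≡_ (element S)
element-injective (true  ∷ S) {zero}  {zero}  _ = refl
element-injective (true  ∷ S) {suc i} {suc j} e =
  cong suc (element-injective S (Fin.suc-injective e))
element-injective (false ∷ S) e = element-injective S (Fin.suc-injective e)

-- The subgraph of G induced on S.

infix 9 _[_]

_[_] : (G : Graph) → VertexSet G → Graph
G [ S ] = record
  { order  = ∣ S ∣
  ; Adj    = λ i j → Adj G (element S i) (element S j)
  ; adj?   = λ i j → adj? G (element S i) (element S j)
  ; symm   = symm G
  ; irrefl = λ { refl → irrefl G refl }
  }

infix 4 _≅_

_≅_ : Graph → Graph → Set
F ≅ G = Σ[ φ ∈ Vertex F ↔ Vertex G ]
  (∀ u v → Adj F u v ⇔ Adj G (Inverse.to φ u) (Inverse.to φ v))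

-- Finite sets of graphs are given as lists.

Free : List Graph → Graph → Set₁
Free 𝓕 G = All (λ F → ∀ (S : VertexSet G) → ¬ F ≅ G [ S ]) 𝓕

module _ (G : Graph) where

  Clique : VertexSet G → Set
  Clique S = ∀ {u v} → u ∈ S → v ∈ S → u ≢ v → Adj G u v

  Stable : VertexSet G → Set
  Stable S = ∀ {u v} → u ∈ S → v ∈ S → u ≢ v → ¬ Adj G u v

  HasHomogeneousSet≥ : ℝ≥0 → Set
  HasHomogeneousSet≥ x = ∃[ S ] (Clique S ⊎ Stable S) × x ≤ fromℕ ∣ S ∣

ErdősHajnal : List Graph → Set₁
ErdősHajnal 𝓕 = 𝓕 ≢ [] ×
  (∃[ c ] 0ℝ < c × (∀ G → Free 𝓕 G → HasHomogeneousSet≥ G (fromℕ (order G) ^ c)))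

------------------------------------------------------------------------
-- Blockades and combs

Disjoint : ∀ {n} → Subset n → Subset n → Set
Disjoint X Y = Empty (X ∩ Y)

module _ (G : Graph) where

  Complete : VertexSet G → VertexSet G → Set
  Complete X Y = ∀ x → x ∈ X → ∀ y → y ∈ Y → Adj G x y

  AntiComplete : VertexSet G → VertexSet G → Set
  AntiComplete X Y = ∀ x → x ∈ X → ∀ y → y ∈ Y → ¬ Adj G x y

  Pure : VertexSet G → VertexSet G → Set
  Pure X Y = Complete X Y ⊎ AntiComplete X Y

  complete? : Decidable Complete
  complete? X Y = all? λ x → (x ∈? X) →-dec all? λ y → (y ∈? Y) →-dec adj? G x y

  IsBlockade : ∀ {k} → (Fin k → VertexSet G) → Set
  IsBlockade B = ∀ {i j} → i ≢ j → Disjoint (B i) (B j)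

  record IsBlockade[_,_] (ℓ w : ℝ≥0) {k} (B : Fin k → VertexSet G) : Set where
    field
      disjoint : IsBlockade B
      length≥  : ℓ ≤ fromℕ k
      width≥   : ∀ i → w ≤ fromℕ ∣ B i ∣

  Pairwise : (VertexSet G → VertexSet G → Set) → ∀ {k} → (Fin k → VertexSet G) → Set
  Pairwise R B = ∀ {i j} → i ≢ j → R (B i) (B j)

  record Comb (ℓ : ℕ) (w : ℝ≥0) : Set where
    field
      a          : Fin ℓ → Vertex G
      B          : Fin ℓ → VertexSet G
      blockade   : IsBlockade[ fromℕ ℓ , w ] B
      a-distinct : Injective _≡_ _≡_ a
      a∉B        : ∀ i j → a i ∉ B j
      adjacency  : ∀ {i j} → i ≢ j →
                   Complete ⁅ a i ⁆ (B i) × AntiComplete ⁅ a i ⁆ (B j)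

  record IsApex {ℓ w} (K : Comb ℓ w) (v : Vertex G) : Set where
    open Comb K
    field
      v≢a          : ∀ i → v ≢ a i
      v∉B          : ∀ i → v ∉ B i
      complete     : ∀ i → Complete ⁅ v ⁆ (B i)
      antiComplete : ∀ i → ¬ Adj G v (a i)

  pattern-graph : ∀ {t} → (Fin t → VertexSet G) → Graph
  pattern-graph {t} A = record
    { order  = t
    ; Adj    = λ i j → i ≢ j × Complete (A i) (A j)
    ; adj?   = λ i j → ¬? (i Fin.≟ j) ×-dec complete? (A i) (A j)
    ; symm   = λ { (i≢j , c) → i≢j ∘ sym , λ x x∈ y y∈ → symm G (c y y∈ x x∈) }
    ; irrefl = λ { refl (i≢i , _) → i≢i refl }
    }

  -- Parts (X, Y and the blocks of A) are allowed to be empty.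

  record BlockPartition (𝓕₁ 𝓕₂ : List Graph) {ℓ w} (K : Comb ℓ w) (i : Fin ℓ) : Set₁ where
    open Comb K
    field
      X Y             : VertexSet G
      X∪Y≡B           : X ∪ Y ≡ B i
      X∩Y             : Disjoint X Y
      Y-free          : Free 𝓕₁ (G [ Y ])
      t               : ℕ
      A               : Fin t → VertexSet G
      A-covers        : ∀ v → v ∈ X ⇔ (∃[ j ] v ∈ A j)
      A-blockade      : IsBlockade A
      A-pure          : Pairwise Pure A
      A-pattern-free  : Free 𝓕₂ (pattern-graph A)
      outside-pure    : ∀ j {k} → k ≢ i → ∀ u → u ∈ B k → Pure ⁅ u ⁆ (A j)

------------------------------------------------------------------------
-- Property (*)

  -- The condition 0ℝ < k, implied by k ≥ ℓ ^ c₃, makes the quotient meaningful.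

  data Outcome (c₁ c₂ c₃ : ℝ≥0) (ℓ : ℕ) (ℓ>0 : 0 ℕ.< ℓ) (w : ℝ≥0) : Set₁ where
    homogeneous : HasHomogeneousSet≥ G (w ^ c₁) → Outcome c₁ c₂ c₃ ℓ ℓ>0 w
    homogeneous-blockade : ∀ (k : ℝ≥0) (k>0 : 0ℝ < k) → fromℕ ℓ ^ c₃ ≤ k →
      ∀ {m} (B : Fin m → VertexSet G) →
      IsBlockade[ k , w / k ^ c₂ [ ^-positive c₂ k>0 ] ] B →
      Pairwise Complete B ⊎ Pairwise AntiComplete B →
      Outcome c₁ c₂ c₃ ℓ ℓ>0 w
    pure-blockade : ∀ {m} (B : Fin m → VertexSet G) →
      IsBlockade[ fromℕ ℓ , w / fromℕ (ℓ ℕ.^ 2) [ fromℕ-positive (ℕ.m^n>0 ℓ {{ℕ.>-nonZero ℓ>0}} 2) ] ] B →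
      Pairwise Pure B →
      Outcome c₁ c₂ c₃ ℓ ℓ>0 w

Property* : List Graph → Set₁
Property* 𝓗 = ∃[ c₁ ] ∃[ c₂ ] ∃[ c₃ ] 0ℝ < c₁ × 0ℝ < c₂ × 0ℝ < c₃ ×
  (∀ G → Free (map complement 𝓗) G →
   ∀ ℓ w (4≤ℓ : 4 ℕ.≤ ℓ) → fromℕ 4 ≤ w → (K : Comb G ℓ w) →
   (∃[ v ] IsApex G K v) →
   Outcome G c₁ c₂ c₃ ℓ (ℕ.≤-trans (ℕ.s≤s ℕ.z≤n) 4≤ℓ) w)

{-# OPTIONS --safe #-}

-- An Erdős–Hajnal exponent c > 0 is replaced by a natural number m: every 𝓕-free graph on
-- n ≥ 2 vertices has a homogeneous set S with n ≤ |S|^m.  Fix a comb with partitions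
-- Bᵢ = Xᵢ ∪ Yᵢ, Xᵢ = ⋃ⱼ Aⁱⱼ.  If every i has some j with |Aⁱⱼ| ≥ |Bᵢ| / ℓ², these sets form a
-- pure blockade by (2.3).  Otherwise fix an i without such a j.  If |Yᵢ| ≥ |Bᵢ| / 2, a
-- homogeneous set is found in Yᵢ.  If |Xᵢ| > |Bᵢ| / 2, some N ≥ ℓ has N blocks of size at
-- least |Bᵢ| / N²: else the p-th largest block has fewer than |Bᵢ| / max(p, ℓ)² elements, and
-- summing over p gives |Xᵢ| ≤ 2 |Bᵢ| / ℓ ≤ |Bᵢ| / 2.  A homogeneous set of size k ≥ N^(1/m) in
-- the pattern of these N blocks is a complete or anti-complete blockade with blocks of size
-- at least |Bᵢ| / k^(2m).

module Submission where

open import Defs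
open import Data.List using (List; map)
open import Data.Nat as ℕ using (ℕ)
open import Data.Product using (∃-syntax)

open import Algebra.Bundles using (CommutativeRing)
open import Data.Bool using (true; false)
open import Data.Fin using (Fin; zero; suc; cast)
import Data.Fin.Properties as Fin
open import Data.Fin.Subset using (Subset; _∈_; _∪_; _⊆_; ⊥; ⁅_⁆; ∣_∣; ⋃)
import Data.Fin.Subset.Properties as Subset
open import Data.Integer as ℤ using (+_)
import Data.Integer.Properties as ℤ
open import Data.List as List using ([]; _∷_; length; filter)
import Data.List.Properties as List
import Data.List.Relation.Binary.Permutation.Propositional as Perm using (↭-sym)
import Data.List.Relation.Binary.Permutation.Propositional.Properties as Perm
open import Data.List.Relation.Unary.All as All using (All; []; _∷_)
import Data.List.Relation.Unary.All.Properties as All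
open import Data.List.Relation.Unary.AllPairs using (AllPairs; []; _∷_)
open import Data.List.Relation.Unary.Sorted.TotalOrder.Properties using (Sorted⇒AllPairs)
open import Data.Nat using (zero; suc; z≤n; s≤s; _+_; _*_)
open import Data.Nat.Coprimality as Coprime using (1-coprimeTo)
open import Data.Nat.ListAction using (sum)
open import Data.Nat.ListAction.Properties using (sum-↭)
import Data.Nat.Properties as ℕ
open import Data.Nat.Tactic.RingSolver using (solve-∀)
open import Data.Product using (_×_; _,_; proj₁; proj₂)
open import Data.Rational as ℚ using (ℚ; mkℚ; 0ℚ; 1ℚ; ↥_; ↧ₙ_)
import Data.Rational.Properties as ℚ
import Data.Rational.Unnormalised as ℚᵘ
import Data.Rational.Unnormalised.Properties as ℚᵘ
open import Data.Sum as Sum using (_⊎_; inj₁; inj₂)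
open import Data.Vec as Vec using ([]; _∷_; here; there)
open import Function using (_∘_; _⇔_; Equivalence)
open import Function.Bundles using (_↔_; Inverse; mk↔ₛ′)
open import Function.Construct.Composition using (_↔-∘_)
open import Level using (0ℓ)
open import Relation.Binary.PropositionalEquality hiding ([_])
open import Relation.Nullary using (¬_; yes; no; contradiction; Dec; does)
open import Relation.Nullary.Decidable using (from-yes; toSum)
open import Relation.Unary using (Pred; Decidable)

open import Algebra.Definitions.RawSemiring ℚ.+-*-rawSemiring using () renaming (_^_ to _^ℚ_)
open import Algebra.Properties.CommutativeSemigroup
  (CommutativeRing.*-commutativeSemigroup ℚ.+-*-commutativeRing) using (interchange)
import Algebra.Properties.Semiring.Exp (CommutativeRing.semiring ℚ.+-*-commutativeRing) as Exp
import Data.List.Sort ℕ.≤-decTotalOrder as Sort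

open ℝ≥0

-- Nonnegative reals against natural numbers

-- The same normal form that `fromℕ` uses, so `Below (fromℕ n) q` unfolds to `q ℚ.< ι n`.
ι : ℕ → ℚ
ι n = mkℚ (+ n) 0 (Coprime.sym (1-coprimeTo n))

ι-mono-≤ : ∀ {m n} → m ℕ.≤ n → ι m ℚ.≤ ι n
ι-mono-≤ m≤n = ℚ.*≤* (ℤ.*-monoʳ-≤-nonNeg (+ 1) (ℤ.+≤+ m≤n))

ι-cancel-≤ : ∀ {m n} → ι m ℚ.≤ ι n → m ℕ.≤ n
ι-cancel-≤ {m} {n} (ℚ.*≤* p) = ℤ.drop‿+≤+ (ℤ.*-cancelʳ-≤-pos (+ m) (+ n) (+ 1) p)

ι-mono-< : ∀ {m n} → m ℕ.< n → ι m ℚ.< ι n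
ι-mono-< m<n = ℚ.≰⇒> (ℕ.<⇒≱ m<n ∘ ι-cancel-≤)

ι-nonNeg : ∀ n → 0ℚ ℚ.≤ ι n
ι-nonNeg n = ι-mono-≤ {0} z≤n

ι-* : ∀ m n → ι (m * n) ≡ ι m ℚ.* ι n
ι-* m n = ℚ.toℚᵘ-injective (ℚᵘ.≃-trans
  (ℚᵘ.*≡* (cong (ℤ._* + 1) (ℤ.pos-* m n)))
  (ℚᵘ.≃-sym (ℚ.toℚᵘ-homo-* (ι m) (ι n))))

ι-^ : ∀ m n → ι (m ℕ.^ n) ≡ ι m ^ℚ n
ι-^ m zero    = refl
ι-^ m (suc n) = trans (ι-* m (m ℕ.^ n)) (cong (ι m ℚ.*_) (ι-^ m n))

*-mono-≤ : ∀ {p q r s} → 0ℚ ℚ.≤ q → 0ℚ ℚ.≤ r → p ℚ.≤ q → r ℚ.≤ s → p ℚ.* r ℚ.≤ q ℚ.* s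
*-mono-≤ {q = q} {r} 0≤q 0≤r p≤q r≤s = ℚ.≤-trans
  (ℚ.*-monoʳ-≤-nonNeg r {{ℚ.nonNegative 0≤r}} p≤q)
  (ℚ.*-monoˡ-≤-nonNeg q {{ℚ.nonNegative 0≤q}} r≤s)

^-nonNeg : ∀ {x} n → 0ℚ ℚ.≤ x → 0ℚ ℚ.≤ x ^ℚ n
^-nonNeg     zero    _   = ℚ.nonNegative⁻¹ 1ℚ
^-nonNeg {x} (suc n) 0≤x = subst (ℚ._≤ x ^ℚ suc n) (ℚ.*-zeroˡ 0ℚ)
  (*-mono-≤ 0≤x ℚ.≤-refl 0≤x (^-nonNeg n 0≤x))

^-monoˡ-≤ : ∀ {x y} n → 0ℚ ℚ.≤ x → x ℚ.≤ y → x ^ℚ n ℚ.≤ y ^ℚ n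
^-monoˡ-≤ zero    _   _   = ℚ.≤-refl
^-monoˡ-≤ (suc n) 0≤x x≤y =
  *-mono-≤ (ℚ.≤-trans 0≤x x≤y) (^-nonNeg n 0≤x) x≤y (^-monoˡ-≤ n 0≤x x≤y)

^-monoˡ-< : ∀ {x y} n .{{_ : ℕ.NonZero n}} → 0ℚ ℚ.≤ x → x ℚ.< y → x ^ℚ n ℚ.< y ^ℚ n
^-monoˡ-< (suc zero) _ x<y = subst₂ ℚ._<_ (sym (ℚ.*-identityʳ _)) (sym (ℚ.*-identityʳ _)) x<y
^-monoˡ-< {x} {y} (suc n@(suc _)) 0≤x x<y = ℚ.≤-<-trans
  (ℚ.*-monoʳ-≤-nonNeg (x ^ℚ n) {{ℚ.nonNegative (^-nonNeg n 0≤x)}} (ℚ.<⇒≤ x<y))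
  (ℚ.*-monoʳ-<-pos y {{ℚ.positive (ℚ.≤-<-trans 0≤x x<y)}} (^-monoˡ-< n 0≤x x<y))

≤-fromℕ : ∀ {m n} → m ℕ.≤ n → fromℕ m ≤ fromℕ n
≤-fromℕ m≤n q<m = ℚ.<-≤-trans q<m (ι-mono-≤ m≤n)

fromℕ-cancel-≤ : ∀ {m n} → fromℕ m ≤ fromℕ n → m ℕ.≤ n
fromℕ-cancel-≤ m≤n = ℕ.≮⇒≥ (ℚ.<-irrefl refl ∘ m≤n ∘ ι-mono-<)

-- A rational `q` below the quotient comes with `u` at least `y`, hence at least `b`. If `a` were at
-- most `q`, then `a * b` would be at most `q * u`, which lies below `x`.
/-≤-fromℕ : ∀ x y (y>0 : 0ℝ < y) {a b} → x ≤ fromℕ (a * b) → fromℕ b ≤ y →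
  x / y [ y>0 ] ≤ fromℕ a
/-≤-fromℕ x y y>0 {a} {b} x≤ab b≤y {q} (u , 0<u , u∉y , qu<x) = ℚ.≰⇒> λ a≤q →
  ℚ.<-irrefl refl (ℚ.<-≤-trans (x≤ab qu<x) (subst (ℚ._≤ q ℚ.* u) (sym (ι-* a b))
    (*-mono-≤ (ℚ.≤-trans (ι-nonNeg a) a≤q) (ι-nonNeg b) a≤q (ℚ.≮⇒≥ (u∉y ∘ b≤y)))))

-- Exponents 1/m and powers of cuts

unitFraction : ℕ → ℚ
unitFraction n = mkℚ (+ 1) n (1-coprimeTo (suc n))

1/suc : ℕ → ℝ≥0
1/suc n = record
  { Below    = ℚ._< unitFraction n
  ; negative = λ q<0 → ℚ.<-trans q<0 (ℚ.positive⁻¹ (unitFraction n))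
  ; down     = ℚ.≤-<-trans
  ; open′    = λ q<r → let p , q<p , p<r = ℚ.<-dense q<r in p , q<p , p<r
  ; bounded  = unitFraction n , ℚ.<-irrefl refl
  }

1/suc-positive : ∀ n → 0ℝ < 1/suc n
1/suc-positive n = 0ℚ , ℚ.<-irrefl refl , ℚ.positive⁻¹ (unitFraction n)

numerator-≤ : ∀ {n r} → 0ℚ ℚ.≤ r → r ℚ.≤ unitFraction n → ℤ.∣ ↥ r ∣ * suc n ℕ.≤ ↧ₙ r
numerator-≤ {n} {mkℚ (+ a) b _} _ (ℚ.*≤* p) = ℤ.drop‿+≤+
  (subst₂ ℤ._≤_ (sym (ℤ.pos-* a (suc n))) (ℤ.*-identityˡ (+ suc b)) p)
numerator-≤ {r = mkℚ ℤ.-[1+ _ ] _ _} (ℚ.*≤* ())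

denominator-≤ : ∀ {n s} → unitFraction n ℚ.≤ s → ↧ₙ s ℕ.≤ suc n * ℤ.∣ ↥ s ∣
denominator-≤ {n} {mkℚ (+ a) b _} (ℚ.*≤* p) = ℕ.≤-trans (ℤ.drop‿+≤+
  (subst₂ ℤ._≤_ (ℤ.*-identityˡ (+ suc b)) (sym (ℤ.pos-* a (suc n))) p))
  (ℕ.≤-reflexive (ℕ.*-comm a (suc n)))
denominator-≤ {s = mkℚ ℤ.-[1+ _ ] _ _} (ℚ.*≤* ())

unitFraction-≤ : ∀ {p} → 0ℚ ℚ.< p → unitFraction (ℚ.denominator-1 p) ℚ.≤ p
unitFraction-≤ {mkℚ (+ suc a) b _} _ =
  ℚ.*≤* (ℤ.*-monoʳ-≤-nonNeg (+ suc b) (ℤ.+≤+ {n = suc a} (s≤s z≤n)))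
unitFraction-≤ {mkℚ (+ zero) b _} (ℚ.*<* (ℤ.+<+ ()))
unitFraction-≤ {mkℚ ℤ.-[1+ _ ] b _} (ℚ.*<* ())

-- Openness of the cut gives a positive rational a/b below `c`, and 1/b is at most a/b.
positive-lowerBound : ∀ {c} → 0ℝ < c → ∃[ n ] Below c (unitFraction n)
positive-lowerBound {c} (q , q≮0 , q∈c) =
  let p , q<p , p∈c = open′ c q∈c
      0<p           = ℚ.≤-<-trans (ℚ.≮⇒≥ q≮0) q<p
  in ℚ.denominator-1 p , down c (unitFraction-≤ 0<p) p∈c

-- A witness has y^b ≤ x^a with a/b ≤ 1/m and x < K^m. If K < y, raising to the power m gives K^(bm)
-- < y^(bm) ≤ x^(am) ≤ K^(mam), while mam ≤ bm.
root-≤-fromℕ : ∀ {x K} n → x ≤ fromℕ (K ℕ.^ suc n) → x ^ 1/suc n ≤ fromℕ K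
root-≤-fromℕ {K = K} n _ (inj₁ q<0) = ℚ.<-≤-trans q<0 (ι-nonNeg K)
root-≤-fromℕ {K = K} n x≤Kⁿ (inj₂ w) = ℚ.<-≤-trans q<y (ℚ.≮⇒≥ K≮y)
  where
  open PowerWitness w
  a = ℤ.∣ ↥ r ∣
  b = ↧ₙ r
  m = suc n

  x<Kᵐ : x ℚ.< ι K ^ℚ m
  x<Kᵐ = subst (x ℚ.<_) (ι-^ K m) (x≤Kⁿ x<b)

  r≤1/m : r ℚ.≤ unitFraction n
  r≤1/m = ℚ.≮⇒≥ λ 1/m<r → ℚ.<-irrefl refl (r≤c 1/m<r)

  -- For K = 0 the base would satisfy 0 < x < 0. Monotonicity in the exponent needs a positive base.
  1≤K : 1 ℕ.≤ K
  1≤K = ℕ.≰⇒> λ { z≤n → ℚ.<-irrefl refl (ℚ.<-trans 0<x (x≤Kⁿ x<b)) }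

  Kᵃᵐᵐ≤Kᵇᵐ : K ℕ.^ (m * (a * m)) ℕ.≤ K ℕ.^ (b * m)
  Kᵃᵐᵐ≤Kᵇᵐ = ℕ.^-monoʳ-≤ K {{ℕ.>-nonZero 1≤K}}
    (subst (ℕ._≤ b * m) (ℕ.*-comm (a * m) m)
      (ℕ.*-monoˡ-≤ m (numerator-≤ {n} {r} 0≤r r≤1/m)))

  K≮y : ¬ ι K ℚ.< y
  K≮y K<y = ℚ.<-irrefl refl (begin-strict
    ι K ^ℚ (b * m)          <⟨ ^-monoˡ-< (b * m) (ι-nonNeg K) K<y ⟩
    y ^ℚ (b * m)            ≡⟨ Exp.^-assocʳ y b m ⟨
    (y ^ℚ b) ^ℚ m           ≤⟨ ^-monoˡ-≤ m (^-nonNeg b 0≤y) y≤xʳ ⟩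
    (x ^ℚ a) ^ℚ m           ≡⟨ Exp.^-assocʳ x a m ⟩
    x ^ℚ (a * m)            ≤⟨ ^-monoˡ-≤ (a * m) (ℚ.<⇒≤ 0<x) (ℚ.<⇒≤ x<Kᵐ) ⟩
    (ι K ^ℚ m) ^ℚ (a * m)   ≡⟨ Exp.^-assocʳ (ι K) m (a * m) ⟩
    ι K ^ℚ (m * (a * m))    ≡⟨ ι-^ K (m * (a * m)) ⟨
    ι (K ℕ.^ (m * (a * m))) ≤⟨ ι-mono-≤ Kᵃᵐᵐ≤Kᵇᵐ ⟩
    ι (K ℕ.^ (b * m))       ≡⟨ ι-^ K (b * m) ⟩
    ι K ^ℚ (b * m)          ∎)
    where open ℚ.≤-Reasoning

-- Since a cut has no greatest element, only bases x < K are available; the loss is paid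
-- for by a factor two in the exponent, as (3/4 K)² ≥ K.
pow-≥-fromℕ : ∀ {K} n → 2 ℕ.≤ K → fromℕ (K ℕ.^ n) ≤ fromℕ K ^ fromℕ (2 * n)
pow-≥-fromℕ {K} n 2≤K {q} q<Kⁿ = inj₂ (record
  { y = ι (K ℕ.^ n) ; x = x ; r = ι (2 * n) ; s = ι (2 * n)
  ; q<y = q<Kⁿ ; 0≤y = ι-nonNeg (K ℕ.^ n) ; 0<x = 0<x ; x<b = x<K ; 0≤r = ι-nonNeg (2 * n)
  ; r≤c = λ p<r → p<r ; c≤s = ℚ.<-irrefl refl ; y≤xʳ = y≤x²ⁿ ; y≤xˢ = y≤x²ⁿ })
  where
  open ℚ.≤-Reasoning
  ¾ = (+ 3) ℚ./ 4
  x = ι K ℚ.* ¾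
  K>0 : 0ℚ ℚ.< ι K
  K>0 = ι-mono-< {0} (ℕ.≤-trans (s≤s z≤n) 2≤K)
  instance
    K⁺ : ℚ.Positive (ι K)
    K⁺ = ℚ.positive K>0
    K⁰ : ℚ.NonNegative (ι K)
    K⁰ = ℚ.nonNegative (ℚ.<⇒≤ K>0)
  0<x : 0ℚ ℚ.< x
  0<x = ℚ.positive⁻¹ x {{ℚ.pos*pos⇒pos (ι K) ¾}}
  x<K : x ℚ.< ι K
  x<K = subst (x ℚ.<_) (ℚ.*-identityʳ (ι K)) (ℚ.*-monoʳ-<-pos (ι K) (from-yes (¾ ℚ.<? 1ℚ)))
  K≤x² : ι K ℚ.≤ x ^ℚ 2
  K≤x² = begin
    ι K                         ≡⟨ ℚ.*-identityʳ (ι K) ⟨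
    -- Here 2 (3/4)² = 9/8, which is where K ≥ 2 enters.
    ι K ℚ.* 1ℚ                  ≤⟨ ℚ.*-monoˡ-≤-nonNeg (ι K) (from-yes (1ℚ ℚ.≤? ι 2 ℚ.* (¾ ℚ.* ¾))) ⟩
    ι K ℚ.* (ι 2 ℚ.* (¾ ℚ.* ¾)) ≤⟨ ℚ.*-monoˡ-≤-nonNeg (ι K) (ℚ.*-monoʳ-≤-nonNeg (¾ ℚ.* ¾) (ι-mono-≤ 2≤K)) ⟩
    ι K ℚ.* (ι K ℚ.* (¾ ℚ.* ¾)) ≡⟨ ℚ.*-assoc (ι K) (ι K) (¾ ℚ.* ¾) ⟨
    (ι K ℚ.* ι K) ℚ.* (¾ ℚ.* ¾) ≡⟨ interchange (ι K) (ι K) ¾ ¾ ⟩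
    x ℚ.* x                     ≡⟨ cong (x ℚ.*_) (ℚ.*-identityʳ x) ⟨
    x ^ℚ 2                      ∎
  y≤x²ⁿ : ι (K ℕ.^ n) ≤[ x ^ ι (2 * n) ]
  y≤x²ⁿ = begin
    ι (K ℕ.^ n) ℚ.* 1ℚ ≡⟨ ℚ.*-identityʳ _ ⟩
    ι (K ℕ.^ n)        ≡⟨ ι-^ K n ⟩
    ι K ^ℚ n           ≤⟨ ^-monoˡ-≤ n (ℚ.<⇒≤ K>0) K≤x² ⟩
    (x ^ℚ 2) ^ℚ n      ≡⟨ Exp.^-assocʳ x 2 n ⟩
    x ^ℚ (2 * n)       ∎

-- The bound is suc K rather than K so that y = suc K and x = y ^ suc n witness K < N ^ c.
^-≤-fromℕ : ∀ {c n N K} → Below c (unitFraction n) → fromℕ N ^ c ≤ fromℕ K →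
  N ℕ.≤ suc K ℕ.^ suc n
^-≤-fromℕ {c} {n} {N} {K} 1/m∈c Nᶜ≤K = ℕ.≮⇒≥ λ x<N → ℚ.<-irrefl refl (Nᶜ≤K (inj₂ (record
  { y = y ; x = ι x ; r = unitFraction n ; s = s
  ; q<y = ι-mono-< ℕ.≤-refl ; 0≤y = ι-nonNeg (suc K)
  ; 0<x = ι-mono-< {0} (ℕ.m^n>0 (suc K) m) ; x<b = ι-mono-< x<N
  ; 0≤r = ℚ.nonNegative⁻¹ (unitFraction n) ; r≤c = λ p<r → down c (ℚ.<⇒≤ p<r) 1/m∈c ; c≤s = s∉c
  ; y≤xʳ = ℚ.≤-reflexive (sym (trans (ℚ.*-identityʳ (ι x)) (ι-^ (suc K) m)))
  ; y≤xˢ = y≤xˢ })))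
  where
  m = suc n
  x = suc K ℕ.^ m
  y = ι (suc K)
  s   = proj₁ (bounded c)
  s∉c = proj₂ (bounded c)
  a = ℤ.∣ ℚ.↥ s ∣
  b = ℚ.↧ₙ s
  1/m≤s : unitFraction n ℚ.≤ s
  1/m≤s = ℚ.≮⇒≥ λ s<1/m → s∉c (down c (ℚ.<⇒≤ s<1/m) 1/m∈c)
  -- For s = a/b at least 1/m, b is at most ma, and x^a is the power ma of `suc K`.
  y≤xˢ : y ≤[ ι x ^ s ]
  y≤xˢ = begin
    y ^ℚ b                ≡⟨ ι-^ (suc K) b ⟨
    ι (suc K ℕ.^ b)       ≤⟨ ι-mono-≤ (ℕ.^-monoʳ-≤ (suc K) (denominator-≤ {n} {s} 1/m≤s)) ⟩
    ι (suc K ℕ.^ (m * a)) ≡⟨ cong ι (ℕ.^-*-assoc (suc K) m a) ⟨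
    ι (x ℕ.^ a)           ≡⟨ ι-^ x a ⟩
    ι x ^ℚ a              ∎
    where open ℚ.≤-Reasoning

-- Relative subsets

-- The image of a set of positions under `element T`, built by recursion on `T` so that sizes and
-- enumerations follow by the same induction.
embed : ∀ {n} (T : Subset n) → Subset ∣ T ∣ → Subset n
embed []          []      = []
embed (true  ∷ T) (s ∷ S) = s ∷ embed T S
embed (false ∷ T) S       = false ∷ embed T S

∣embed∣ : ∀ {n} (T : Subset n) S → ∣ embed T S ∣ ≡ ∣ S ∣
∣embed∣ []          []          = refl
∣embed∣ (true  ∷ T) (true  ∷ S) = cong suc (∣embed∣ T S)
∣embed∣ (true  ∷ T) (false ∷ S) = ∣embed∣ T S
∣embed∣ (false ∷ T) S           = ∣embed∣ T S

-- Both enumerations are increasing, so they agree up to the `cast` between equal sizes. This makes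
-- an induced subgraph of an induced subgraph an induced subgraph.
element-embed : ∀ {n} (T : Subset n) S i →
  element (embed T S) (cast (sym (∣embed∣ T S)) i) ≡ element T (element S i)
element-embed []          []          ()
element-embed (true  ∷ T) (true  ∷ S) zero    = refl
element-embed (true  ∷ T) (true  ∷ S) (suc i) = cong suc (element-embed T S i)
element-embed (true  ∷ T) (false ∷ S) i       = cong suc (element-embed T S i)
element-embed (false ∷ T) S           i       = cong suc (element-embed T S i)

∈-embed⁻ : ∀ {n} (T : Subset n) S {u} → u ∈ embed T S → ∃[ i ] i ∈ S × u ≡ element T i
∈-embed⁻ []          []      ()
∈-embed⁻ (true  ∷ T) (s ∷ S) here      = zero , here , refl
∈-embed⁻ (true  ∷ T) (s ∷ S) (there u∈) =
  let i , i∈S , eq = ∈-embed⁻ T S u∈ in suc i , there i∈S , cong suc eq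
∈-embed⁻ (false ∷ T) S       (there u∈) =
  let i , i∈S , eq = ∈-embed⁻ T S u∈ in i , i∈S , cong suc eq

element-∈ : ∀ {n} (S : Subset n) i → element S i ∈ S
element-∈ (true  ∷ S) zero    = here
element-∈ (true  ∷ S) (suc i) = there (element-∈ S i)
element-∈ (false ∷ S) i       = there (element-∈ S i)

cast-↔ : ∀ {m n} → m ≡ n → Fin m ↔ Fin n
cast-↔ eq = mk↔ₛ′ (cast eq) (cast (sym eq))
  (Fin.cast-involutive eq (sym eq)) (Fin.cast-involutive (sym eq) eq)

module _ (G : Graph) (T : VertexSet G) where

  Free-induced : ∀ {𝓕} → Free 𝓕 G → Free 𝓕 (G [ T ])
  Free-induced = All.map λ {F} F-free S (φ , φ-adj) → F-free (embed T S)
    (cast-↔ (sym (∣embed∣ T S)) ↔-∘ φ , λ u v → subst₂ (λ x y → Adj F u v ⇔ Adj G x y)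
      (sym (element-embed T S (Inverse.to φ u))) (sym (element-embed T S (Inverse.to φ v)))
      (φ-adj u v))

  embed-homogeneous : ∀ {S} → Clique (G [ T ]) S ⊎ Stable (G [ T ]) S →
    Clique G (embed T S) ⊎ Stable G (embed T S)
  embed-homogeneous {S} = Sum.map (λ clique → go (Adj G) clique) (λ stable → go (λ u v → ¬ Adj G u v) stable)
    where
    go : (R : Vertex G → Vertex G → Set) →
      (∀ {i j} → i ∈ S → j ∈ S → i ≢ j → R (element T i) (element T j)) →
      ∀ {u v} → u ∈ embed T S → v ∈ embed T S → u ≢ v → R u v
    go R hom u∈ v∈ u≢v with ∈-embed⁻ T S u∈ | ∈-embed⁻ T S v∈
    ... | _ , i∈ , refl | _ , j∈ , refl = hom i∈ j∈ (u≢v ∘ cong (element T))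

-- From the Erdős-Hajnal property to a natural exponent

homogeneous-pair : ∀ G → 2 ℕ.≤ order G → ∃[ S ] (Clique G S ⊎ Stable G S) × ∣ S ∣ ≡ 2
homogeneous-pair record { order = suc (suc n) ; Adj = _~_ ; adj? = adj? ; symm = ~-sym } (s≤s (s≤s _)) =
  true ∷ true ∷ ⊥ ,
  Sum.map (λ a → pairwise {_~_} a (~-sym a)) (λ ¬a → pairwise {λ u v → ¬ u ~ v} ¬a (¬a ∘ ~-sym))
    (toSum (adj? zero (suc zero))) ,
  cong (2 ℕ.+_) (Subset.∣⊥∣≡0 n)
  where
  pairwise : {R : Fin (suc (suc n)) → Fin (suc (suc n)) → Set} → R zero (suc zero) → R (suc zero) zero →
    ∀ {u v} → u ∈ (true ∷ true ∷ ⊥) → v ∈ (true ∷ true ∷ ⊥) → u ≢ v → R u v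
  pairwise r s here             here              u≢v = contradiction refl u≢v
  pairwise r s here             (there here)      _   = r
  pairwise r s (there here)     here              _   = s
  pairwise r s (there here)     (there here)      u≢v = contradiction refl u≢v
  pairwise r s (there (there p)) _                 _   = contradiction p Subset.∉⊥
  pairwise r s _                (there (there p)) _   = contradiction p Subset.∉⊥

PolynomialRamsey : List Graph → ℕ → Set₁
PolynomialRamsey 𝓕 n = ∀ G → Free 𝓕 G → 2 ℕ.≤ order G →
  ∃[ S ] (Clique G S ⊎ Stable G S) × order G ℕ.≤ ∣ S ∣ ℕ.^ suc n

-- An exponent 1/m below `c` bounds the order by (|S| + 1)^m. If |S| ≥ 2, then |S| + 1 ≤ |S|², at
-- the cost of doubling m. Otherwise the order is at most 2^m and any two vertices serve.
erdősHajnal⇒polynomialRamsey : ∀ {𝓕} → ErdősHajnal 𝓕 → ∃[ n ] PolynomialRamsey 𝓕 n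
erdősHajnal⇒polynomialRamsey (_ , c , c>0 , hom) =
  -- `PolynomialRamsey` adds one to its parameter, so `ℕ.pred` yields the exponent 2m.
  let n , 1/m∈c = positive-lowerBound {c} c>0 in ℕ.pred (2 * suc n) , λ G free 2≤G → bound n 1/m∈c G 2≤G (hom G free)
  where
  open ℕ.≤-Reasoning
  bound : ∀ n → Below c (unitFraction n) → ∀ G → 2 ℕ.≤ order G →
    HasHomogeneousSet≥ G (fromℕ (order G) ^ c) →
    ∃[ S ] (Clique G S ⊎ Stable G S) × order G ℕ.≤ ∣ S ∣ ℕ.^ (2 * suc n)
  bound n 1/m∈c G 2≤G (S , S-hom , Gᶜ≤S) with 2 ℕ.≤? ∣ S ∣
  ... | yes 2≤S = S , S-hom , (begin
    order G             ≤⟨ ^-≤-fromℕ {c} {n} 1/m∈c Gᶜ≤S ⟩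
    suc ∣ S ∣ ℕ.^ suc n ≤⟨ ℕ.^-monoˡ-≤ (suc n) (begin
      suc ∣ S ∣     ≤⟨ ℕ.+-monoˡ-≤ ∣ S ∣ (ℕ.<⇒≤ 2≤S) ⟩
      ∣ S ∣ + ∣ S ∣ ≡⟨ cong (∣ S ∣ ℕ.+_) (ℕ.+-identityʳ ∣ S ∣) ⟨
      2 * ∣ S ∣     ≤⟨ ℕ.*-monoˡ-≤ ∣ S ∣ 2≤S ⟩
      ∣ S ∣ * ∣ S ∣ ≡⟨ cong (∣ S ∣ ℕ.*_) (ℕ.*-identityʳ ∣ S ∣) ⟨
      ∣ S ∣ ℕ.^ 2   ∎) ⟩
    (∣ S ∣ ℕ.^ 2) ℕ.^ suc n ≡⟨ ℕ.^-*-assoc ∣ S ∣ 2 (suc n) ⟩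
    ∣ S ∣ ℕ.^ (2 * suc n)   ∎)
  ... | no 2≰S = let P , P-hom , ∣P∣≡2 = homogeneous-pair G 2≤G in P , P-hom , (begin
    order G               ≤⟨ ^-≤-fromℕ {c} {n} 1/m∈c Gᶜ≤S ⟩
    suc ∣ S ∣ ℕ.^ suc n   ≤⟨ ℕ.^-monoˡ-≤ (suc n) (ℕ.≰⇒> 2≰S) ⟩
    2 ℕ.^ suc n           ≤⟨ ℕ.^-monoʳ-≤ 2 (ℕ.m≤n*m (suc n) 2) ⟩
    2 ℕ.^ (2 * suc n)     ≡⟨ cong (ℕ._^ (2 * suc n)) ∣P∣≡2 ⟨
    ∣ P ∣ ℕ.^ (2 * suc n) ∎)

-- Many blocks of comparable size

big? : ∀ W N s → Dec (W ℕ.≤ s * (N * N))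
big? W N s = W ℕ.≤? s * (N * N)

-- At least N entries have size at least W / N², multiplied out. One N controls both number and
-- size, which is the trade-off in `homogeneous-blockade`.
Popular : ℕ → ℕ → List ℕ → Set
Popular ℓ W xs = ∃[ N ] ℓ ℕ.≤ N × N ℕ.≤ length (filter (big? W N) xs)

length-filter-∷ : ∀ {A : Set} {P : Pred A 0ℓ} (P? : Decidable P) x xs →
  length (filter P? xs) ℕ.≤ length (filter P? (x ∷ xs))
length-filter-∷ P? x xs with P? x
... | yes _ = ℕ.n≤1+n _
... | no  _ = ℕ.≤-refl

sum-bound : ∀ {c W xs} → All (λ s → s * c ℕ.≤ W) xs → sum xs * c ℕ.≤ length xs * W
sum-bound []                     = z≤n
sum-bound {c} {xs = x ∷ xs} (p ∷ ps) =
  ℕ.≤-trans (ℕ.≤-reflexive (ℕ.*-distribʳ-+ c x (sum xs))) (ℕ.+-mono-≤ p (sum-bound ps))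

-- The bound S ≤ W (2/ℓ - 1/n) passes from n to n + 1, since x ≤ W/(n+1)² ≤ W (1/n - 1/(n+1)).
telescope : ∀ {ℓ W x S} n .{{_ : ℕ.NonZero n}} →
  x * (suc n * suc n) ℕ.≤ W →
  ℓ * n * S + W * ℓ ℕ.≤ 2 * n * W →
  ℓ * suc n * (x + S) + W * ℓ ℕ.≤ 2 * suc n * W
telescope {ℓ} {W} {x} {S} n small ih = ℕ.*-cancelˡ-≤ n (ℕ.+-cancelʳ-≤ (W * ℓ) _ _ (begin
  n * (ℓ * suc n * (x + S) + W * ℓ) + W * ℓ
    ≡⟨ lhs ℓ W x S n ⟩
  suc n * (ℓ * n * S + W * ℓ) + ℓ * (x * (n * suc n))
    ≤⟨ ℕ.+-mono-≤ (ℕ.*-monoʳ-≤ (suc n) ih) (ℕ.*-monoʳ-≤ ℓ (ℕ.≤-trans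
         (ℕ.*-monoʳ-≤ x (ℕ.*-monoˡ-≤ (suc n) (ℕ.n≤1+n n))) small)) ⟩
  suc n * (2 * n * W) + ℓ * W
    ≡⟨ rhs ℓ W n ⟩
  n * (2 * suc n * W) + W * ℓ ∎))
  where
  open ℕ.≤-Reasoning
  lhs : ∀ ℓ W x S n → n * (ℓ * suc n * (x + S) + W * ℓ) + W * ℓ
    ≡ suc n * (ℓ * n * S + W * ℓ) + ℓ * (x * (n * suc n))
  lhs = solve-∀
  rhs : ∀ ℓ W n → suc n * (2 * n * W) + ℓ * W
    ≡ n * (2 * suc n * W) + W * ℓ
  rhs = solve-∀

-- Without truncated subtraction: ∑ xs ≤ W (2 / ℓ − 1 / n) with n = length xs.  The sum
-- telescopes because the least of n + 1 elements is at most W / (n + 1)².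
sorted-sum-bound : ∀ {ℓ W xs} .{{_ : ℕ.NonZero ℓ}} → AllPairs ℕ._≤_ xs →
  All (λ s → s * (ℓ * ℓ) ℕ.≤ W) xs → ℓ ℕ.≤ length xs →
  Popular ℓ W xs ⊎ ℓ * length xs * sum xs + W * ℓ ℕ.≤ 2 * length xs * W
sorted-sum-bound {ℓ} {W} [] small ℓ≤0 with refl ← ℕ.n≤0⇒n≡0 ℓ≤0 =
  inj₂ (ℕ.≤-reflexive (ℕ.*-zeroʳ W))
sorted-sum-bound {ℓ} {W} {x ∷ xs} (x≤xs ∷ sorted) small ℓ≤n with ℕ.m≤n⇒m<n∨m≡n ℓ≤n
-- With exactly ℓ entries, each at most W/ℓ², the sum is at most W/ℓ = W (2/ℓ - 1/ℓ).
... | inj₂ refl = inj₂ (ℕ.≤-trans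
        (ℕ.+-monoˡ-≤ (W * ℓ) (ℕ.≤-trans (ℕ.≤-reflexive (ℕ.*-comm (ℓ * ℓ) _)) (sum-bound small)))
        (ℕ.≤-reflexive (double ℓ W)))
  where
  double : ∀ ℓ W → ℓ * W + W * ℓ ≡ 2 * ℓ * W
  double = solve-∀
... | inj₁ (s≤s ℓ≤n′) with sorted-sum-bound sorted (All.tail small) ℓ≤n′
...   | inj₁ (N , ℓ≤N , N≤) = inj₁ (N , ℓ≤N , ℕ.≤-trans N≤ (length-filter-∷ (big? W N) x xs))
...   | inj₂ ih with big? W (length (x ∷ xs)) x
-- The head is the least entry, so every entry passes the threshold and N is the full length.
...     | yes big = inj₁ (length (x ∷ xs) , ℓ≤n , ℕ.≤-reflexive (cong length (sym
            (List.filter-all (big? W (length (x ∷ xs)))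
              (big ∷ All.map (λ x≤y → ℕ.≤-trans big (ℕ.*-monoˡ-≤ _ x≤y)) x≤xs)))))
...     | no ¬big = inj₂ (telescope (length xs)
            {{ℕ.>-nonZero (ℕ.≤-trans (ℕ.>-nonZero⁻¹ ℓ) ℓ≤n′)}} (ℕ.<⇒≤ (ℕ.≰⇒> ¬big)) ih)

-- Sorting changes neither the sum nor the counts. Without a suitable N the sum would be at most
-- 2W/ℓ, hence at most W/2.
popular : ∀ {ℓ W xs} → 4 ℕ.≤ ℓ → All (λ s → s * (ℓ * ℓ) ℕ.≤ W) xs →
  W ℕ.< 2 * sum xs → Popular ℓ W xs
popular {ℓ} {W} {xs} 4≤ℓ small W<2Σ = back (by-length (ℓ ℕ.≤? length ys))
  where
  instance
    ℓ≢0 : ℕ.NonZero ℓ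
    ℓ≢0 = ℕ.>-nonZero (ℕ.≤-trans (s≤s z≤n) 4≤ℓ)
  ys  = Sort.sort xs
  ys↭ = Sort.sort-↭ xs
  small′ = Perm.All-resp-↭ (Perm.↭-sym ys↭) small

  back : Popular ℓ W ys → Popular ℓ W xs
  back (N , ℓ≤N , N≤) = N , ℓ≤N ,
    ℕ.≤-trans N≤ (ℕ.≤-reflexive (Perm.↭-length (Perm.filter-↭ (big? W N) ys↭)))

  W<ΣΣ : W ℕ.< 2 * sum ys
  W<ΣΣ = subst (λ S → W ℕ.< 2 * S) (sym (sum-↭ ys↭)) W<2Σ

  absurd : ¬ ℓ * sum ys ℕ.≤ 2 * W
  absurd h = ℕ.<⇒≱ W<ΣΣ (ℕ.*-cancelˡ-≤ 2 (begin
    2 * (2 * sum ys) ≡⟨ ℕ.*-assoc 2 2 (sum ys) ⟨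
    4 * sum ys       ≤⟨ ℕ.*-monoˡ-≤ (sum ys) 4≤ℓ ⟩
    ℓ * sum ys       ≤⟨ h ⟩
    2 * W            ∎))
    where open ℕ.≤-Reasoning

  rearrange : ∀ n ℓ S → n * (ℓ * S) ≡ ℓ * n * S
  rearrange = solve-∀

  rearrange′ : ∀ n W → 2 * n * W ≡ n * (2 * W)
  rearrange′ = solve-∀

  by-length : Dec (ℓ ℕ.≤ length ys) → Popular ℓ W ys
  -- Fewer than ℓ entries, each at most W/ℓ², sum to at most W/ℓ.
  by-length (no ℓ≰n) = contradiction (ℕ.≤-trans ℓΣ≤W (ℕ.m≤n*m W 2)) absurd
    where
    open ℕ.≤-Reasoning
    ℓΣ≤W : ℓ * sum ys ℕ.≤ W
    ℓΣ≤W = ℕ.*-cancelˡ-≤ ℓ (begin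
      ℓ * (ℓ * sum ys) ≡⟨ rearrange ℓ ℓ (sum ys) ⟩
      ℓ * ℓ * sum ys   ≡⟨ ℕ.*-comm (ℓ * ℓ) (sum ys) ⟩
      sum ys * (ℓ * ℓ) ≤⟨ sum-bound small′ ⟩
      length ys * W    ≤⟨ ℕ.*-monoˡ-≤ W (ℕ.<⇒≤ (ℕ.≰⇒> ℓ≰n)) ⟩
      ℓ * W            ∎)
  by-length (yes ℓ≤n) with sorted-sum-bound (Sorted⇒AllPairs ℕ.≤-totalOrder (Sort.sort-↗ xs)) small′ ℓ≤n
  ... | inj₁ found = found
  ... | inj₂ bound = contradiction (ℕ.*-cancelˡ-≤ (length ys)
          {{ℕ.>-nonZero (ℕ.≤-trans (ℕ.>-nonZero⁻¹ ℓ) ℓ≤n)}} (begin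
      length ys * (ℓ * sum ys)       ≡⟨ rearrange (length ys) ℓ (sum ys) ⟩
      ℓ * length ys * sum ys         ≤⟨ ℕ.m≤m+n _ (W * ℓ) ⟩
      ℓ * length ys * sum ys + W * ℓ ≤⟨ bound ⟩
      2 * length ys * W              ≡⟨ rearrange′ (length ys) W ⟩
      length ys * (2 * W)            ∎)) absurd
    where open ℕ.≤-Reasoning

-- Cardinalities of unions and index sets, and purity between blocks

∣∪∣≤ : ∀ {n} (p q : Subset n) → ∣ p ∪ q ∣ ℕ.≤ ∣ p ∣ + ∣ q ∣
∣∪∣≤ []          []          = z≤n
∣∪∣≤ (true  ∷ p) (true  ∷ q) = s≤s (ℕ.≤-trans (∣∪∣≤ p q) (ℕ.+-monoʳ-≤ ∣ p ∣ (ℕ.n≤1+n ∣ q ∣)))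
∣∪∣≤ (true  ∷ p) (false ∷ q) = s≤s (∣∪∣≤ p q)
∣∪∣≤ (false ∷ p) (true  ∷ q) = ℕ.≤-trans (s≤s (∣∪∣≤ p q)) (ℕ.≤-reflexive (sym (ℕ.+-suc ∣ p ∣ ∣ q ∣)))
∣∪∣≤ (false ∷ p) (false ∷ q) = ∣∪∣≤ p q

cover-≤ : ∀ {n t} {X : Subset n} (A : Fin t → Subset n) → (∀ {v} → v ∈ X → ∃[ j ] v ∈ A j) →
  ∣ X ∣ ℕ.≤ sum (List.tabulate (∣_∣ ∘ A))
cover-≤ {X = X} A cover = ℕ.≤-trans
  (Subset.p⊆q⇒∣p∣≤∣q∣ (λ v∈X → let j , v∈Aj = cover v∈X in A⊆⋃ A j v∈Aj)) (∣⋃∣≤ A)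
  where
  A⊆⋃ : ∀ {n t} (A : Fin t → Subset n) j → A j ⊆ ⋃ (List.tabulate A)
  A⊆⋃ A zero    v∈ = Subset.p⊆p∪q (⋃ (List.tabulate (A ∘ suc))) v∈
  A⊆⋃ A (suc j) v∈ = Subset.q⊆p∪q (A zero) _ (A⊆⋃ (A ∘ suc) j v∈)

  ∣⋃∣≤ : ∀ {n t} (A : Fin t → Subset n) → ∣ ⋃ (List.tabulate A) ∣ ℕ.≤ sum (List.tabulate (∣_∣ ∘ A))
  ∣⋃∣≤ {n} {zero}  A = ℕ.≤-reflexive (Subset.∣⊥∣≡0 n)
  ∣⋃∣≤ {n} {suc t} A = ℕ.≤-trans (∣∪∣≤ (A zero) _) (ℕ.+-monoʳ-≤ ∣ A zero ∣ (∣⋃∣≤ (A ∘ suc)))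

module _ {A : Set} {P : Pred A 0ℓ} (P? : Decidable P) where

  preimage : ∀ {t} → (Fin t → A) → Subset t
  preimage f = Vec.tabulate (does ∘ P? ∘ f)

  -- Turns a count of entries in a list of block sizes into the size of a set of block indices.
  ∣preimage∣ : ∀ {t} (f : Fin t → A) → ∣ preimage f ∣ ≡ length (filter P? (List.tabulate f))
  ∣preimage∣ {zero}  f = refl
  ∣preimage∣ {suc t} f with does (P? (f zero))
  ... | true  = cong suc (∣preimage∣ (f ∘ suc))
  ... | false = ∣preimage∣ (f ∘ suc)

  ∈-preimage⁻ : ∀ {t} (f : Fin t → A) {j} → j ∈ preimage f → P (f j)
  ∈-preimage⁻ f {zero}  j∈ with P? (f zero)
  ∈-preimage⁻ f {zero}  here | yes p = p
  ∈-preimage⁻ f {suc j} (there j∈) = ∈-preimage⁻ (f ∘ suc) j∈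

-- The relation of one vertex x of X to Z decides all pairs: each z in Z treats the whole of X as it
-- treats x.
pure-blocks : ∀ G {X Z} → (∀ u → u ∈ X → Pure G ⁅ u ⁆ Z) → (∀ u → u ∈ Z → Pure G ⁅ u ⁆ X) → Pure G X Z
pure-blocks G {X} {Z} X→Z Z→X with Subset.nonempty? X
... | no empty = inj₁ λ x x∈ → contradiction (x , x∈) empty
... | yes (x , x∈) = Sum.map
  (λ c u u∈ z z∈ → case-complete (c x (Subset.x∈⁅x⁆ x) z z∈) u∈ z∈)
  (λ a u u∈ z z∈ → case-anti (a x (Subset.x∈⁅x⁆ x) z z∈) u∈ z∈)
  (X→Z x x∈)
  where
  case-complete : ∀ {u z} → Adj G x z → u ∈ X → z ∈ Z → Adj G u z
  case-complete {u} {z} xz u∈ z∈ with Z→X z z∈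
  ... | inj₁ c = symm G (c z (Subset.x∈⁅x⁆ z) u u∈)
  ... | inj₂ a = contradiction (symm G xz) (a z (Subset.x∈⁅x⁆ z) x x∈)
  case-anti : ∀ {u z} → ¬ Adj G x z → u ∈ X → z ∈ Z → ¬ Adj G u z
  case-anti {u} {z} ¬xz u∈ z∈ with Z→X z z∈
  ... | inj₁ c = contradiction (symm G (c z (Subset.x∈⁅x⁆ z) x x∈)) ¬xz
  ... | inj₂ a = a z (Subset.x∈⁅x⁆ z) u u∈ ∘ symm G

-- Combs

1<m^n⇒1<m : ∀ {m} n → 1 ℕ.< m ℕ.^ n → 1 ℕ.< m
1<m^n⇒1<m {m} n 1<mⁿ = ℕ.≰⇒> λ m≤1 →
  ℕ.<⇒≱ 1<mⁿ (ℕ.≤-trans (ℕ.^-monoˡ-≤ n m≤1) (ℕ.≤-reflexive (ℕ.^-zeroˡ n)))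

module _ (G : Graph) where

  -- With m = n + 1, b ≤ 2|Y| ≤ |Y|² ≤ |S|^(2m), as |Y| ≥ 2. The exponent in the conclusion is
  -- 1/(2m).
  homogeneous-from-half : ∀ {𝓕 n w b} → PolynomialRamsey 𝓕 n →
    ∀ Y → Free 𝓕 (G [ Y ]) → 4 ℕ.≤ b → w ≤ fromℕ b → b ℕ.≤ 2 * ∣ Y ∣ →
    HasHomogeneousSet≥ G (w ^ 1/suc (suc (n * 2)))
  homogeneous-from-half {n = n} {w} {b} ramsey Y Y-free 4≤b w≤b b≤2Y =
    let S , S-hom , Y≤Sᵐ = ramsey (G [ Y ]) Y-free 2≤Y
    in embed Y S , embed-homogeneous G Y S-hom ,
       subst (λ k → w ^ 1/suc (suc (n * 2)) ≤ fromℕ k) (sym (∣embed∣ Y S))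
         (root-≤-fromℕ (suc (n * 2)) (≤-fromℕ (b≤ S Y≤Sᵐ) ∘ w≤b))
    where
    open ℕ.≤-Reasoning
    2≤Y : 2 ℕ.≤ ∣ Y ∣
    2≤Y = ℕ.*-cancelˡ-≤ 2 (ℕ.≤-trans 4≤b b≤2Y)
    b≤ : ∀ S → ∣ Y ∣ ℕ.≤ ∣ S ∣ ℕ.^ suc n → b ℕ.≤ ∣ S ∣ ℕ.^ (suc n * 2)
    b≤ S Y≤Sᵐ = begin
      b                       ≤⟨ b≤2Y ⟩
      2 * ∣ Y ∣               ≤⟨ ℕ.*-monoˡ-≤ ∣ Y ∣ 2≤Y ⟩
      ∣ Y ∣ * ∣ Y ∣           ≡⟨ cong (∣ Y ∣ ℕ.*_) (ℕ.*-identityʳ ∣ Y ∣) ⟨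
      ∣ Y ∣ ℕ.^ 2             ≤⟨ ℕ.^-monoˡ-≤ 2 Y≤Sᵐ ⟩
      (∣ S ∣ ℕ.^ suc n) ℕ.^ 2 ≡⟨ ℕ.^-*-assoc ∣ S ∣ (suc n) 2 ⟩
      ∣ S ∣ ℕ.^ (suc n * 2)   ∎

  module _ {t} {A : Fin t → VertexSet G} (pure : Pairwise G (Pure G) A) where

    -- A non-edge of the pattern only says that two blocks are not complete; purity turns this into
    -- anti-complete.
    homogeneous-pattern : ∀ {S} →
      Clique (pattern-graph G A) S ⊎ Stable (pattern-graph G A) S →
      Pairwise G (Complete G) (A ∘ element S) ⊎ Pairwise G (AntiComplete G) (A ∘ element S)
    homogeneous-pattern {S} (inj₁ clique) = inj₁ λ {i} {j} i≢j →
      proj₂ (clique (element-∈ S i) (element-∈ S j) (i≢j ∘ element-injective S))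
    homogeneous-pattern {S} (inj₂ stable) = inj₂ λ {i} {j} i≢j →
      let i≢j′ = i≢j ∘ element-injective S
      in Sum.[ (λ c → contradiction (i≢j′ , c) (stable (element-∈ S i) (element-∈ S j) i≢j′))
             , (λ a → a) ] (pure i≢j′)

    blockade-from-pattern : ∀ {𝓕 n ℓ w b} → PolynomialRamsey 𝓕 n →
      IsBlockade G A → Free 𝓕 (pattern-graph G A) →
      ∀ T → 2 ℕ.≤ ∣ T ∣ → ℓ ℕ.≤ ∣ T ∣ → w ≤ fromℕ b →
      (∀ {j} → j ∈ T → b ℕ.≤ ∣ A j ∣ * (∣ T ∣ * ∣ T ∣)) →
      ∀ {c₁} (ℓ>0 : 0 ℕ.< ℓ) → Outcome G c₁ (fromℕ (2 * (suc n * 2))) (1/suc n) ℓ ℓ>0 w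
    blockade-from-pattern {n = n} {ℓ} {w} {b} ramsey blockade pattern-free T 2≤T ℓ≤T w≤b big ℓ>0 =
      from (ramsey (pattern-graph G A [ T ]) (Free-induced (pattern-graph G A) T pattern-free) 2≤T)
      where
      -- With m = n + 1 and k = |R|, |T|² ≤ k^(2m) asks for the exponent 2m, and `pow-≥-fromℕ`
      -- doubles it.
      c₂ = fromℕ (2 * (suc n * 2))
      from : _ → Outcome G _ c₂ (1/suc n) ℓ ℓ>0 w
      from (S , S-hom , T≤Sᵐ) = homogeneous-blockade (fromℕ ∣ R ∣) (fromℕ-positive (ℕ.<⇒≤ 2≤R))
        (root-≤-fromℕ n (≤-fromℕ (ℕ.≤-trans ℓ≤T T≤Rᵐ)))
        (A ∘ element R) (record
          { disjoint = λ i≢j → blockade (i≢j ∘ element-injective R)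
          ; length≥  = λ q< → q<
          ; width≥   = λ i → /-≤-fromℕ w (fromℕ ∣ R ∣ ^ c₂)
              (^-positive c₂ (fromℕ-positive (ℕ.<⇒≤ 2≤R)))
              (≤-fromℕ (b≤ i) ∘ w≤b) (pow-≥-fromℕ (suc n * 2) 2≤R)
          })
        (homogeneous-pattern (embed-homogeneous (pattern-graph G A) T S-hom))
        where
        open ℕ.≤-Reasoning
        R = embed T S
        T≤Rᵐ : ∣ T ∣ ℕ.≤ ∣ R ∣ ℕ.^ suc n
        T≤Rᵐ = subst (λ k → ∣ T ∣ ℕ.≤ k ℕ.^ suc n) (sym (∣embed∣ T S)) T≤Sᵐ
        -- A set of size at most one would force |T| ≤ 1.
        2≤R : 2 ℕ.≤ ∣ R ∣
        2≤R = 1<m^n⇒1<m (suc n) (ℕ.≤-trans 2≤T T≤Rᵐ)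
        R⊆T : ∀ {j} → j ∈ R → j ∈ T
        R⊆T j∈R with ∈-embed⁻ T S j∈R
        ... | i , _ , refl = element-∈ T i
        b≤ : ∀ i → b ℕ.≤ ∣ A (element R i) ∣ * ∣ R ∣ ℕ.^ (suc n * 2)
        b≤ i = begin
          b                           ≤⟨ big (R⊆T (element-∈ R i)) ⟩
          a * (∣ T ∣ * ∣ T ∣)         ≡⟨ cong (λ k → a * (∣ T ∣ * k)) (ℕ.*-identityʳ ∣ T ∣) ⟨
          a * ∣ T ∣ ℕ.^ 2             ≤⟨ ℕ.*-monoʳ-≤ a (ℕ.^-monoˡ-≤ 2 T≤Rᵐ) ⟩
          a * (∣ R ∣ ℕ.^ suc n) ℕ.^ 2 ≡⟨ cong (a ℕ.*_) (ℕ.^-*-assoc ∣ R ∣ (suc n) 2) ⟩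
          a * ∣ R ∣ ℕ.^ (suc n * 2)   ∎
          where a = ∣ A (element R i) ∣

    popular-blocks : ∀ {ℓ b X} → 4 ℕ.≤ ℓ → (∀ {v} → v ∈ X → ∃[ j ] v ∈ A j) → b ℕ.< 2 * ∣ X ∣ →
      (∀ j → ∣ A j ∣ * (ℓ * ℓ) ℕ.≤ b) →
      ∃[ T ] ℓ ℕ.≤ ∣ T ∣ × (∀ {j} → j ∈ T → b ℕ.≤ ∣ A j ∣ * (∣ T ∣ * ∣ T ∣))
    popular-blocks {ℓ} {b} 4≤ℓ covers b<2X small =
      let N , ℓ≤N , N≤ = popular 4≤ℓ (All.tabulate⁺ small)
                           (ℕ.<-≤-trans b<2X (ℕ.*-monoʳ-≤ 2 (cover-≤ A covers)))
          T = preimage (big? b N) (∣_∣ ∘ A)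
          N≤T = ℕ.≤-trans N≤ (ℕ.≤-reflexive (sym (∣preimage∣ (big? b N) (∣_∣ ∘ A))))
      -- T may have more than N elements, which only lowers the required size b/|T|².
      in T , ℕ.≤-trans ℓ≤N N≤T , λ j∈T → ℕ.≤-trans (∈-preimage⁻ (big? b N) (∣_∣ ∘ A) j∈T)
           (ℕ.*-monoʳ-≤ ∣ A _ ∣ (ℕ.*-mono-≤ N≤T N≤T))

  module _ {𝓕₁ 𝓕₂ n₁ n₂} (ramsey₁ : PolynomialRamsey 𝓕₁ n₁) (ramsey₂ : PolynomialRamsey 𝓕₂ n₂)
    {ℓ w} (4≤ℓ : 4 ℕ.≤ ℓ) (4≤w : fromℕ 4 ≤ w) (K : Comb G ℓ w)
    (parts : ∀ i → BlockPartition G 𝓕₁ 𝓕₂ K i) where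

    open Comb K
    open IsBlockade[_,_] blockade
    open module P i = BlockPartition (parts i)

    A⊆B : ∀ i j → A i j ⊆ B i
    A⊆B i j v∈ = subst (_ ∈_) (X∪Y≡B i) (Subset.p⊆p∪q (Y i) (Equivalence.from (A-covers i _) (j , v∈)))

    large? : ∀ i → Dec (∃[ j ] ∣ B i ∣ ℕ.≤ ∣ A i j ∣ * (ℓ ℕ.^ 2))
    large? i = Fin.any? λ j → ∣ B i ∣ ℕ.≤? ∣ A i j ∣ * (ℓ ℕ.^ 2)

    comb-outcome : ∀ ℓ>0 →
      Outcome G (1/suc (suc (n₁ * 2))) (fromℕ (2 * (suc n₂ * 2))) (1/suc n₂) ℓ ℓ>0 w
    comb-outcome ℓ>0 with Fin.all? large?
    ... | yes large = pure-blockade A′ (record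
            { disjoint = λ {i} {j} i≢j (v , v∈) → let v∈Ai , v∈Aj = Subset.x∈p∩q⁻ _ _ v∈ in
                disjoint i≢j (v , Subset.x∈p∩q⁺ (A⊆B i _ v∈Ai , A⊆B j _ v∈Aj))
            ; length≥  = λ q< → q<
            ; width≥   = λ i → /-≤-fromℕ w (fromℕ (ℓ ℕ.^ 2))
                (fromℕ-positive (ℕ.m^n>0 ℓ {{ℕ.>-nonZero ℓ>0}} 2))
                (≤-fromℕ (proj₂ (large i)) ∘ width≥ i) (λ q< → q<)
            })
          -- The chosen part with index i lies in `B i`, so `outside-pure` for j applies to its
          -- vertices, and symmetrically.
          (λ {i} {j} i≢j → pure-blocks G
            (λ u u∈ → outside-pure j _ i≢j u (A⊆B i _ u∈))
            (λ u u∈ → outside-pure i _ (i≢j ∘ sym) u (A⊆B j _ u∈)))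
      where
      A′ : Fin ℓ → VertexSet G
      A′ i = A i (proj₁ (large i))
    ... | no ¬large with Fin.¬∀⟶∃¬ ℓ _ large? ¬large
    ...   | i , none with ∣ B i ∣ ℕ.≤? 2 * ∣ Y i ∣
    ...     | yes B≤2Y = homogeneous (homogeneous-from-half {n = n₁} ramsey₁ (Y i) (Y-free i)
                (fromℕ-cancel-≤ (width≥ i ∘ 4≤w)) (width≥ i) B≤2Y)
    ...     | no B≰2Y =
      let T , ℓ≤T , big = popular-blocks (A-pure i) 4≤ℓ (Equivalence.to (A-covers i _)) B<2X small
      in blockade-from-pattern (A-pure i) {n = n₂} ramsey₂ (A-blockade i) (A-pattern-free i) T
           (ℕ.≤-trans (ℕ.≤-trans (s≤s (s≤s z≤n)) 4≤ℓ) ℓ≤T) ℓ≤T (width≥ i) big ℓ>0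
      where
      small : ∀ j → ∣ A i j ∣ * (ℓ * ℓ) ℕ.≤ ∣ B i ∣
      small j = subst (λ k → ∣ A i j ∣ * (ℓ * k) ℕ.≤ ∣ B i ∣) (ℕ.*-identityʳ ℓ)
        (ℕ.≰⇒≥ λ le → none (j , le))
      B<2X : ∣ B i ∣ ℕ.< 2 * ∣ X i ∣
      B<2X = ℕ.+-cancelʳ-< ∣ B i ∣ _ _ (begin-strict
        ∣ B i ∣ + ∣ B i ∣                         ≤⟨ ℕ.+-mono-≤ B≤X+Y B≤X+Y ⟩
        (∣ X i ∣ + ∣ Y i ∣) + (∣ X i ∣ + ∣ Y i ∣) ≡⟨ rearrange ∣ X i ∣ ∣ Y i ∣ ⟩
        2 * ∣ X i ∣ + 2 * ∣ Y i ∣                 <⟨ ℕ.+-monoʳ-< (2 * ∣ X i ∣) (ℕ.≰⇒> B≰2Y) ⟩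
        2 * ∣ X i ∣ + ∣ B i ∣                     ∎)
        where
        open ℕ.≤-Reasoning
        B≤X+Y : ∣ B i ∣ ℕ.≤ ∣ X i ∣ + ∣ Y i ∣
        B≤X+Y = subst (λ Z → ∣ Z ∣ ℕ.≤ ∣ X i ∣ + ∣ Y i ∣) (X∪Y≡B i) (∣∪∣≤ (X i) (Y i))
        rearrange : ∀ x y → (x + y) + (x + y) ≡ 2 * x + 2 * y
        rearrange = solve-∀

lemma1p14 : (𝓕₁ 𝓕₂ 𝓗 : List Graph) → ErdősHajnal 𝓕₁ → ErdősHajnal 𝓕₂ →
    (∀ G → Free (map complement 𝓗) G →
    ∀ ℓ w → 4 ℕ.≤ ℓ → fromℕ 4 ≤ w → (K : Comb G ℓ w) →
    (∃[ v ] IsApex G K v) →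
    ∀ i → BlockPartition G 𝓕₁ 𝓕₂ K i) →
    Property* 𝓗
lemma1p14 𝓕₁ 𝓕₂ 𝓗 EH₁ EH₂ partition =
  let n₁ , ramsey₁ = erdősHajnal⇒polynomialRamsey EH₁
      n₂ , ramsey₂ = erdősHajnal⇒polynomialRamsey EH₂
  -- With m₁ = n₁ + 1 and m₂ = n₂ + 1 the constants are 1/(2m₁), 4m₂ and 1/m₂, fixed before the
  -- graph and the comb.
  in 1/suc (suc (n₁ * 2)) , fromℕ (2 * (suc n₂ * 2)) , 1/suc n₂ ,
     1/suc-positive _ , fromℕ-positive (s≤s z≤n) , 1/suc-positive n₂ ,
     λ G G-free ℓ w 4≤ℓ 4≤w K apex → comb-outcome G {n₁ = n₁} {n₂} ramsey₁ ramsey₂ 4≤ℓ 4≤w K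
       (partition G G-free ℓ w 4≤ℓ 4≤w K apex) _
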